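{- Fix an integer $k\ge 2$. For each $n\in\mathbb{N}$, let $I_{k,n}$ be the number of subsets of $\{1,2,\ldots,n\}$ that (1) satisfy the $k$-Zeckendorf condition, (2) contain $n$, and (3) are strong-Schreier. Then $$I_{k,n}=\begin{cases}0, & \text{if } n=1;\\ 1, & \text{if } 2\le n\le k+2;\\ I_{k,n-1}+I_{k,n-(k+1)}, & \text{if } n>k+2.\end{cases}$$
   Context: $\mathbb{N}=\{1,2,3,\ldots\}$. A nonempty finite set $S\subseteq\mathbb{N}$ is strong-Schreier if $\min S> |S|$. A finite set of natural numbers satisfies the $k$-Zeckendorf condition if any two distinct numbers in the set are at least $k$ apart (singletons satisfy this vacuously). -}

module Defs where

open import Data.Bool.Base using (true; false)
open import Data.Fin.Base using (Fin; toℕ)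
import Data.Fin.Properties as Fin
open import Data.Fin.Subset using (Subset; Side; inside; outside; _∈_; ∣_∣)
open import Data.Fin.Subset.Properties using (_∈?_)
open import Data.List.Base
  using (List; []; _∷_; length; filter; cartesianProductWith)
import Data.List.Membership.Propositional as List
open import Data.List.Membership.Propositional.Properties
  using (∈-cartesianProductWith⁺)
open import Data.List.Relation.Unary.All using ([]; _∷_)
open import Data.List.Relation.Unary.AllPairs using ([]; _∷_)
open import Data.List.Relation.Unary.Any using (here; there)
open import Data.List.Relation.Unary.Unique.Propositional using (Unique)
open import Data.List.Relation.Unary.Unique.Propositional.Properties
  using (cartesianProductWith⁺)
open import Data.Nat.Base using (ℕ; zero; suc; _≤_; _<_; ∣_-_∣)
open import Data.Nat.Properties using (_≟_; _≤?_; _<?_)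
open import Data.Product.Base using (_×_; ∃)
open import Data.Vec.Base using ([]; _∷_)
open import Data.Vec.Properties using (∷-injective)
open import Relation.Binary.PropositionalEquality using (_≡_; _≢_; refl)
open import Relation.Nullary.Decidable using (¬?; _×-dec_; _→-dec_)
open import Relation.Unary using (Pred; Decidable)
open import Level using (0ℓ)

private
  variable
    n : ℕ

-- A value of Subset n is read as a subset of {1, …, n}, so the index i
-- (which counts from 0) stands for the number 1 + i.
value : Fin n → ℕ
value i = suc (toℕ i)

Contains : ℕ → Subset n → Set
Contains m S = ∃ λ i → i ∈ S × value i ≡ m

Zeckendorf : ℕ → Subset n → Set
Zeckendorf k S =
  ∀ i j → i ∈ S → j ∈ S → i ≢ j → k ≤ ∣ value i - value j ∣

IsMinimum : Fin n → Subset n → Set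
IsMinimum i S = i ∈ S × (∀ j → j ∈ S → value i ≤ value j)

-- Nonemptiness is part of having a minimum.
StrongSchreier : Subset n → Set
StrongSchreier S = ∃ λ i → IsMinimum i S × ∣ S ∣ < value i

Admissible : ℕ → (n : ℕ) → Subset n → Set
Admissible k n S = Zeckendorf k S × Contains n S × StrongSchreier S

contains? : ∀ m → Decidable (Contains {n} m)
contains? m S = Fin.any? λ i → (i ∈? S) ×-dec (value i ≟ m)

zeckendorf? : ∀ k → Decidable (Zeckendorf {n} k)
zeckendorf? k S = Fin.all? λ i → Fin.all? λ j →
  (i ∈? S) →-dec ((j ∈? S) →-dec
    (¬? (i Fin.≟ j) →-dec (k ≤? ∣ value i - value j ∣)))

isMinimum? : ∀ (i : Fin n) → Decidable (IsMinimum i)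
isMinimum? i S =
  (i ∈? S) ×-dec (Fin.all? λ j → (j ∈? S) →-dec (value i ≤? value j))

strongSchreier? : Decidable (StrongSchreier {n})
strongSchreier? S =
  Fin.any? λ i → isMinimum? i S ×-dec (∣ S ∣ <? value i)

admissible? : ∀ k n → Decidable (Admissible k n)
admissible? k n S =
  zeckendorf? k S ×-dec (contains? n S ×-dec strongSchreier? S)

sides : List Side
sides = outside ∷ inside ∷ []

allSubsets : ∀ n → List (Subset n)
allSubsets zero    = [] ∷ []
allSubsets (suc n) =
  cartesianProductWith _∷_ sides (allSubsets n)

-- Every subset occurs in allSubsets exactly once, so the length of a filtered
-- allSubsets is the number of subsets with the given property.
∈-allSubsets : (S : Subset n) → S List.∈ allSubsets n
∈-allSubsets []          = here refl
∈-allSubsets (false ∷ S) =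
  ∈-cartesianProductWith⁺ _∷_ {xs = sides} (here refl) (∈-allSubsets S)
∈-allSubsets (true ∷ S)  =
  ∈-cartesianProductWith⁺ _∷_ {xs = sides} (there (here refl)) (∈-allSubsets S)

allSubsets-unique : ∀ n → Unique (allSubsets n)
allSubsets-unique zero    = [] ∷ []
allSubsets-unique (suc n) = cartesianProductWith⁺ _∷_ ∷-injective
  (((λ ()) ∷ []) ∷ [] ∷ []) (allSubsets-unique n)

countSubsets : {P : Pred (Subset n) 0ℓ} → Decidable P → ℕ
countSubsets {n} P? = length (filter P? (allSubsets n))

I : ℕ → ℕ → ℕ
I k n = countSubsets (admissible? k n)

{-# OPTIONS --safe #-}

-- Split a set by its least element m and by the gaps between consecutive
-- elements.  Being strong-Schreier then means having fewer than m - 1 gaps, and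
-- these gaps form a composition of n - m into parts ≥ k.  Either the first part
-- exceeds k and can be decremented, or it equals k and can be removed, which
-- uses up one unit of the bound on their number.  Summing this alternative over
-- m gives the recurrence.

module Submission where

open import Defs
open import Data.Nat.Base using (ℕ; _+_; _∸_; _≤_; _<_)
open import Data.Product.Base using (_×_)
open import Relation.Binary.PropositionalEquality using (_≡_)

open import Data.Empty using (⊥-elim)
open import Data.Fin.Base using (zero; suc)
open import Data.Fin.Properties using (suc-injective)
open import Data.Fin.Subset using (Subset; inside; outside; _∈_; ∣_∣)
open import Data.List.Base using (List; []; _∷_; _++_; map; length; filter)
open import Data.List.Properties
  using (length-++; filter-++; filter-≐; filter-none; ++-identityʳ)
open import Data.List.Relation.Unary.All using (universal)
open import Data.Nat.Base using (zero; suc; z≤n; s≤s; s≤s⁻¹)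
open import Data.Nat.Properties
  using ( +-comm; +-suc; +-identityʳ; +-monoʳ-≤; +-commutativeSemigroup
        ; ≤-refl; ≤-trans; <⇒≤; n≮0; n≤1+n; m≤m+n; m+[n∸m]≡n)
open import Data.Product.Base using (_,_; ∃; proj₁; proj₂)
open import Data.Vec.Base using ([]; _∷_; here; there)
open import Function.Base using (_∘_)
open import Algebra.Properties.CommutativeSemigroup +-commutativeSemigroup
  using (interchange)
open import Level using (0ℓ)
open import Relation.Binary.PropositionalEquality
  using (refl; sym; trans; cong; cong₂; subst; module ≡-Reasoning)
open import Relation.Nullary using (¬_; yes; no)
open import Relation.Nullary.Decidable using (map′)
open import Relation.Unary using (Pred; Decidable; _≐_)

-- Counting subsets by their first entry

private
  variable
    n : ℕ

-- Quantifying over all deciders makes counts composable: splitting on the head produces deciders of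
-- the form `λ S → P? (x ∷ S)`, which need not match any decider fixed in advance.
HasCount : Pred (Subset n) 0ℓ → ℕ → Set
HasCount P c = (P? : Decidable P) → countSubsets P? ≡ c

module _ {A B : Set} {P : Pred B 0ℓ} (P? : Decidable P) (f : A → B) where

  length-filter-map : ∀ xs →
    length (filter P? (map f xs)) ≡ length (filter (λ x → P? (f x)) xs)
  length-filter-map []       = refl
  length-filter-map (x ∷ xs) with P? (f x)
  ... | yes _ = cong suc (length-filter-map xs)
  ... | no  _ = length-filter-map xs

hasCount-∷ : ∀ {P : Pred (Subset (suc n)) 0ℓ} {c d} →
  HasCount (λ S → P (outside ∷ S)) c → HasCount (λ S → P (inside ∷ S)) d →
  HasCount P (c + d)
hasCount-∷ {n} {P} {c} {d} hc hd P? = begin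
  length (filter P? (outs ++ ins ++ []))
    ≡⟨ cong (λ xs → length (filter P? (outs ++ xs))) (++-identityʳ ins) ⟩
  length (filter P? (outs ++ ins))
    ≡⟨ cong length (filter-++ P? outs ins) ⟩
  length (filter P? outs ++ filter P? ins)
    ≡⟨ length-++ (filter P? outs) ⟩
  length (filter P? outs) + length (filter P? ins)
    ≡⟨ cong₂ _+_
         (trans (length-filter-map P? (outside ∷_) (allSubsets n)) (hc _))
         (trans (length-filter-map P? (inside ∷_) (allSubsets n)) (hd _)) ⟩
  c + d ∎
  where
  open ≡-Reasoning
  outs ins : List (Subset (suc n))
  outs = map (outside ∷_) (allSubsets n)
  ins  = map (inside ∷_) (allSubsets n)

hasCount-resp : ∀ {P Q : Pred (Subset n) 0ℓ} {c} →
  P ≐ Q → HasCount Q c → HasCount P c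
hasCount-resp {n} {P} {Q} P≐Q hc P? =
  trans (cong length (filter-≐ P? Q? P≐Q (allSubsets n))) (hc Q?)
  where
  Q? : Decidable Q
  Q? S = map′ (proj₁ P≐Q) (proj₂ P≐Q) (P? S)

hasCount-none : ∀ {P : Pred (Subset n) 0ℓ} → (∀ S → ¬ P S) → HasCount P 0
hasCount-none {n} ¬P P? =
  cong length (filter-none P? (universal ¬P (allSubsets n)))

hasCount-[] : ∀ {P : Pred (Subset 0) 0ℓ} → P [] → HasCount P 1
hasCount-[] p P? with P? []
... | yes _ = refl
... | no ¬p = ⊥-elim (¬p p)

-- Gap and membership conditions under prepending an entry

Beyond : ℕ → Subset n → Set
Beyond d S = ∀ i → i ∈ S → d < value i

beyond-outside : ∀ {d} {S : Subset n} → Beyond d S → Beyond (suc d) (outside ∷ S)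
beyond-outside h (suc i) (there p) = s≤s (h i p)

beyond-outside⁻ : ∀ {d} {S : Subset n} → Beyond (suc d) (outside ∷ S) → Beyond d S
beyond-outside⁻ h i p = s≤s⁻¹ (h (suc i) (there p))

beyond-zero : ∀ (S : Subset n) → Beyond 0 S
beyond-zero S i p = s≤s z≤n

zeckendorf-tail : ∀ {k x} {S : Subset n} → Zeckendorf k (x ∷ S) → Zeckendorf k S
zeckendorf-tail z i j p q i≢j =
  z (suc i) (suc j) (there p) (there q) (i≢j ∘ suc-injective)

zeckendorf-outside : ∀ {k} {S : Subset n} → Zeckendorf k S → Zeckendorf k (outside ∷ S)
zeckendorf-outside z (suc i) (suc j) (there p) (there q) i≢j =
  z i j p q (i≢j ∘ cong suc)

-- The head has value 1, so its distance to the element `j` of the tail reduces to `value j`, and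
-- `Beyond κ` is literally the bound `suc κ` on these distances.
zeckendorf-inside : ∀ {κ} {S : Subset n} →
  Zeckendorf (suc κ) S → Beyond κ S → Zeckendorf (suc κ) (inside ∷ S)
zeckendorf-inside z h zero    zero    p q i≢j = ⊥-elim (i≢j refl)
zeckendorf-inside z h zero    (suc j) p (there q) i≢j = h j q
zeckendorf-inside z h (suc i) zero    (there p) q i≢j = h i p
zeckendorf-inside z h (suc i) (suc j) (there p) (there q) i≢j =
  z i j p q (i≢j ∘ cong suc)

zeckendorf-inside⁻ : ∀ {κ} {S : Subset n} → Zeckendorf (suc κ) (inside ∷ S) → Beyond κ S
zeckendorf-inside⁻ z j q = z zero (suc j) here (there q) (λ ())

contains-∷ : ∀ {m x} {S : Subset n} → Contains m S → Contains (suc m) (x ∷ S)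
contains-∷ (i , p , eq) = suc i , there p , cong suc eq

contains-outside⁻ : ∀ {m} {S : Subset n} → Contains (suc m) (outside ∷ S) → Contains m S
contains-outside⁻ (suc i , there p , refl) = i , p , refl

contains-∷⁻ : ∀ {m x} {S : Subset n} → Contains (suc (suc m)) (x ∷ S) → Contains (suc m) S
contains-∷⁻ (suc i , there p , refl) = i , p , refl

-- Counts by least element and gaps

module Counting (κ : ℕ) where

  k : ℕ
  k = suc κ

  -- An element has just been chosen; S is what follows it.
  Chosen : ℕ → Subset n → Set
  Chosen {n} b S =
    Zeckendorf k (inside ∷ S) × Contains (suc n) (inside ∷ S) × ∣ S ∣ < b

  -- `d` is the number of positions still blocked by the previous element, `b` the number of
  -- elements that may yet be placed.
  Rest : ℕ → ℕ → Subset n → Set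
  Rest {n} d b S = Zeckendorf k S × Contains n S × Beyond d S × ∣ S ∣ ≤ b

  -- Admissible sets preceded by a unoccupied numbers.
  Shifted : ℕ → Subset n → Set
  Shifted {n} a S = Zeckendorf k S × Contains n S ×
    (∃ λ i → IsMinimum i S × ∣ S ∣ < a + value i)

  -- `#chosen b r` is the number of compositions of `r` into fewer than `b` parts, all at least `k`.
  -- In `#rest d b r` there are between one and `b` parts, the first exceeding `d` and the others at
  -- least `k`.
  #chosen : ℕ → ℕ → ℕ
  #rest : ℕ → ℕ → ℕ → ℕ

  #chosen zero    r       = 0
  #chosen (suc b) zero    = 1
  #chosen (suc b) (suc r) = #rest κ b (suc r)

  -- The last number has yet to be reached here; the case where the chosen element is itself the
  -- last one is the value 1 of `#chosen`.
  #rest d       b zero    = 0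
  #rest (suc d) b (suc r) = #rest d b r
  #rest zero    b (suc r) = #rest zero b r + #chosen b r

  #shifted : ℕ → ℕ → ℕ
  #shifted a zero    = 0
  #shifted a (suc n) = #shifted (suc a) n + #chosen a n

  chosen-[] : ∀ {b} → Chosen (suc b) []
  chosen-[] = (λ { zero zero _ _ i≢j → ⊥-elim (i≢j refl) })
            , (zero , here , refl) , s≤s z≤n

  chosen≐rest : ∀ {b} → Chosen {suc n} (suc b) ≐ Rest κ b
  chosen≐rest =
      (λ (z , c , s) → zeckendorf-tail z , contains-∷⁻ c , zeckendorf-inside⁻ z , s≤s⁻¹ s)
    , (λ (z , c , h , s) → zeckendorf-inside z h , contains-∷ c , s≤s s)

  rest-outside-suc : ∀ {d b} →
    (λ (S : Subset n) → Rest (suc d) b (outside ∷ S)) ≐ Rest d b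
  rest-outside-suc =
      (λ (z , c , h , s) → zeckendorf-tail z , contains-outside⁻ c , beyond-outside⁻ h , s)
    , (λ (z , c , h , s) → zeckendorf-outside z , contains-∷ c , beyond-outside h , s)

  rest-outside-zero : ∀ {b} →
    (λ (S : Subset n) → Rest zero b (outside ∷ S)) ≐ Rest zero b
  rest-outside-zero =
      (λ {S} (z , c , h , s) → zeckendorf-tail z , contains-outside⁻ c , beyond-zero S , s)
    , (λ {S} (z , c , h , s) →
         zeckendorf-outside z , contains-∷ c , beyond-zero (outside ∷ S) , s)

  rest-inside : ∀ {b} →
    (λ (S : Subset n) → Rest zero b (inside ∷ S)) ≐ Chosen b
  rest-inside =
      (λ (z , c , h , s) → z , c , s)
    , (λ {S} (z , c , s) → z , c , beyond-zero (inside ∷ S) , s)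

  shifted-outside : ∀ {a} →
    (λ (S : Subset n) → Shifted a (outside ∷ S)) ≐ Shifted (suc a)
  shifted-outside {a = a} =
      (λ { {S} (z , c , suc i , (there p , min) , s) →
           zeckendorf-tail z , contains-outside⁻ c , i
         , (p , λ j q → s≤s⁻¹ (min (suc j) (there q)))
         , subst (∣ S ∣ <_) (+-suc a (value i)) s })
    , (λ { {S} (z , c , i , (p , min) , s) →
           zeckendorf-outside z , contains-∷ c , suc i
         , (there p , λ { (suc j) (there q) → s≤s (min j q) })
         , subst (∣ S ∣ <_) (sym (+-suc a (value i))) s })

  shifted-inside : ∀ {a} →
    (λ (S : Subset n) → Shifted a (inside ∷ S)) ≐ Chosen a
  shifted-inside {a = a} =
      -- The minimum need not be identified with the head: comparing it with the head gives
      -- `value i ≤ 1`, which is enough for the bound.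
      (λ { {S} (z , c , i , (p , min) , s) → z , c
         , s≤s⁻¹ (subst (suc ∣ S ∣ <_) (+-comm a 1)
             (≤-trans s (+-monoʳ-≤ a (min zero here)))) })
    , (λ {S} (z , c , s) → z , c , zero
         , (here , λ j q → s≤s z≤n)
         , subst (suc ∣ S ∣ <_) (+-comm 1 a) (s≤s s))

  hasCount-chosen : ∀ b r → HasCount {r} (Chosen b) (#chosen b r)
  hasCount-rest   : ∀ d b r → HasCount {r} (Rest d b) (#rest d b r)

  hasCount-chosen zero    r       = hasCount-none λ { S (_ , _ , ()) }
  hasCount-chosen (suc b) zero    = hasCount-[] chosen-[]
  hasCount-chosen (suc b) (suc r) =
    hasCount-resp chosen≐rest (hasCount-rest κ b (suc r))

  hasCount-rest d       b zero    = hasCount-none λ { S (_ , (() , _) , _) }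
  hasCount-rest (suc d) b (suc r) = subst (HasCount _) (+-identityʳ _)
    (hasCount-∷
      (hasCount-resp rest-outside-suc (hasCount-rest d b r))
      (hasCount-none λ S (_ , _ , h , _) → n≮0 (s≤s⁻¹ (h zero here))))
  hasCount-rest zero    b (suc r) = hasCount-∷
    (hasCount-resp rest-outside-zero (hasCount-rest zero b r))
    (hasCount-resp rest-inside (hasCount-chosen b r))

  hasCount-shifted : ∀ a n → HasCount {n} (Shifted a) (#shifted a n)
  hasCount-shifted a zero    = hasCount-none λ { S (_ , (() , _) , _) }
  hasCount-shifted a (suc n) = hasCount-∷
    (hasCount-resp shifted-outside (hasCount-shifted (suc a) n))
    (hasCount-resp shifted-inside (hasCount-chosen a n))

  -- `Shifted 0` unfolds to `Admissible k n`, so the count applies to `admissible?` directly.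
  I≡#shifted : ∀ n → I k n ≡ #shifted 0 n
  I≡#shifted n = hasCount-shifted 0 n (admissible? k n)

  -- Boundary cases and initial values

  #rest-wait : ∀ d b r → #rest d b (d + r) ≡ #rest 0 b r
  #rest-wait zero    b r = refl
  #rest-wait (suc d) b r = #rest-wait d b r

  #rest-short : ∀ d b {r} → r ≤ d → #rest d b r ≡ 0
  #rest-short d       b z≤n       = refl
  #rest-short (suc d) b (s≤s r≤d) = #rest-short d b r≤d

  -- With no element left to place, the last number cannot be reached.
  #rest-no-budget : ∀ d r → #rest d 0 r ≡ 0
  #rest-no-budget d       zero    = refl
  #rest-no-budget (suc d) (suc r) = #rest-no-budget d r
  #rest-no-budget zero    (suc r) = cong (_+ 0) (#rest-no-budget zero r)

  -- Among at most `k` consecutive numbers no two are `k` apart, so only the singleton of the last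
  -- one remains; `suc a` makes it strong-Schreier.
  #shifted-short : ∀ a {m} → m ≤ κ → #shifted (suc a) (suc m) ≡ 1
  #shifted-short a z≤n         = refl
  #shifted-short a {suc m} m<κ =
    cong₂ _+_ (#shifted-short (suc a) (<⇒≤ m<κ)) (#rest-short κ a m<κ)

  -- Least element 1 is impossible and least element 2 allows no gap. From 3 on, at most `k` numbers
  -- are left.
  #shifted-one : ∀ {m} → m ≤ k → #shifted 0 (suc (suc m)) ≡ 1
  #shifted-one {zero}  _         = refl
  #shifted-one {suc m} (s≤s m≤κ) = trans (+-identityʳ _)
    (cong₂ _+_ (#shifted-short 1 m≤κ) (#rest-no-budget κ (suc m)))

-- The recurrence, for `k` at least 2

module Recurrence (κ′ : ℕ) where

  private
    κ : ℕ
    κ = suc κ′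

  open Counting κ

  #chosen-rec : ∀ b i → #chosen (suc b) (k + i) ≡ #chosen (suc b) (κ + i) + #chosen b i
  #chosen-rec b i = begin
    #rest κ b (suc (κ + i))           ≡⟨ cong (#rest κ b) (+-suc κ i) ⟨
    #rest κ b (κ + suc i)             ≡⟨ #rest-wait κ b (suc i) ⟩
    -- After the `κ` blocked positions, the next one is either skipped (first part above `k`) or
    -- taken (first part equal to `k`).
    #rest 0 b i + #chosen b i         ≡⟨ cong (_+ #chosen b i) (#rest-wait κ b i) ⟨
    -- `#chosen (suc b) (κ + i)` unfolds to `#rest` because `κ` is a successor; this uses `k ≥ 2`.
    #rest κ b (κ + i) + #chosen b i   ∎
    where open ≡-Reasoning

  -- Removing a gap `k` costs one unit of the bound, so the least element also moves down by one.
  -- This lowers `a` on the right and accounts for the total drop of `k + 1` in the recurrence for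
  -- `I`.
  #shifted-rec : ∀ a i →
    #shifted (suc a) (k + i) ≡ #shifted (suc a) (κ + i) + #shifted a i
  #shifted-rec a zero = begin
    #shifted (suc a) (suc (κ + 0))     ≡⟨ cong (#shifted (suc a) ∘ suc) (+-identityʳ κ) ⟩
    #shifted (suc a) (suc κ)           ≡⟨ #shifted-short a ≤-refl ⟩
    -- Here `k ≥ 2` is used again: the `κ` available numbers include at least one.
    1                                  ≡⟨ #shifted-short a (n≤1+n κ′) ⟨
    #shifted (suc a) κ                 ≡⟨ cong (#shifted (suc a)) (+-identityʳ κ) ⟨
    #shifted (suc a) (κ + 0)           ≡⟨ +-identityʳ _ ⟨
    #shifted (suc a) (κ + 0) + 0       ∎
    where open ≡-Reasoning
  #shifted-rec a (suc i) = begin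
    #shifted (suc a) (k + suc i)
      ≡⟨ cong (#shifted (suc a)) (+-suc k i) ⟩
    #shifted (suc (suc a)) (k + i) + #chosen (suc a) (k + i)
      ≡⟨ cong₂ _+_ (#shifted-rec (suc a) i) (#chosen-rec a i) ⟩
    (#shifted (suc (suc a)) (κ + i) + #shifted (suc a) i)
      + (#chosen (suc a) (κ + i) + #chosen a i)
      ≡⟨ interchange (#shifted (suc (suc a)) (κ + i)) (#shifted (suc a) i)
                     (#chosen (suc a) (κ + i)) (#chosen a i) ⟩
    #shifted (suc a) (suc (κ + i)) + #shifted a (suc i)
      ≡⟨ cong (λ m → #shifted (suc a) m + #shifted a (suc i)) (+-suc κ i) ⟨
    #shifted (suc a) (κ + suc i) + #shifted a (suc i) ∎
    where
    open ≡-Reasoning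

  I-rec : ∀ i → I k (suc k + i) ≡ I k (k + i) + I k i
  I-rec i = begin
    I k (suc k + i)                           ≡⟨ I≡#shifted (suc k + i) ⟩
    -- The summand 0 is `#chosen 0`: the number 1 is never the least element.
    #shifted 1 (k + i) + 0                    ≡⟨ +-identityʳ _ ⟩
    #shifted 1 (k + i)                        ≡⟨ #shifted-rec 0 i ⟩
    #shifted 1 (κ + i) + #shifted 0 i         ≡⟨ cong (_+ #shifted 0 i) (+-identityʳ _) ⟨
    #shifted 0 (k + i) + #shifted 0 i         ≡⟨ cong₂ _+_ (I≡#shifted (k + i)) (I≡#shifted i) ⟨
    I k (k + i) + I k i                       ∎
    where open ≡-Reasoning

theorem5 : ∀ (k : ℕ) → 2 ≤ k → ∀ (n : ℕ) → 1 ≤ n →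
    (n ≡ 1 → I k n ≡ 0)
    × (2 ≤ n → n ≤ k + 2 → I k n ≡ 1)
    × (k + 2 < n → I k n ≡ I k (n ∸ 1) + I k (n ∸ (k + 1)))
theorem5 (suc (suc κ′)) (s≤s (s≤s z≤n)) n _ = one , short , long
  where
  open Counting (suc κ′)
  open Recurrence κ′

  one : n ≡ 1 → I k n ≡ 0
  one refl = I≡#shifted 1

  short : 2 ≤ n → n ≤ k + 2 → I k n ≡ 1
  short (s≤s (s≤s {n = m} _)) n≤k+2 = trans (I≡#shifted (suc (suc m)))
    (#shifted-one (s≤s⁻¹ (s≤s⁻¹ (subst (n ≤_) (+-comm k 2) n≤k+2))))

  long : k + 2 < n → I k n ≡ I k (n ∸ 1) + I k (n ∸ (k + 1))
  long k+2<n = begin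
    I k n
      ≡⟨ cong (I k) n≡ ⟨
    I k (suc k + i)
      ≡⟨ I-rec i ⟩
    I k (k + i) + I k i
      ≡⟨ cong (λ m → I k (m ∸ 1) + I k i) n≡ ⟩
    I k (n ∸ 1) + I k i
      ≡⟨ cong (λ m → I k (n ∸ 1) + I k (n ∸ m)) (+-comm 1 k) ⟩
    I k (n ∸ 1) + I k (n ∸ (k + 1)) ∎
    where
    open ≡-Reasoning
    i : ℕ
    i = n ∸ suc k
    n≡ : suc k + i ≡ n
    n≡ = m+[n∸m]≡n (≤-trans (s≤s (m≤m+n k 2)) k+2<n)
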